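{- Let $(W,S)$ be a finite Coxeter system, $Q=q_1\cdots q_m$ a non-empty word on $S$, $\rho\in W$, and let $Q_\dashv=q_1\cdots q_{m-1}$. Then the negative sink tree $\mathcal N^*(Q,\rho)$ equals (i) $\mathcal N^*(Q_\dashv,\rho q_m)$ if $m$ appears in none of the facets of $\mathcal{SC}(Q,\rho)$; (ii) $\mathcal N^*(Q_\dashv,\rho)\star m$ if $m$ appears in all the facets of $\mathcal{SC}(Q,\rho)$; (iii) the disjoint union of $\mathcal N^*(Q_\dashv,\rho q_m)$ and $\mathcal N^*(Q_\dashv,\rho)\star m$, with an additional edge from $\mathsf N(Q_\dashv,\rho q_m)$ to $\mathsf N(Q,\rho)=\mathsf N(Q_\dashv,\rho)\cup\{m\}$, otherwise.
   Context: Let $(W,S)$ be a finite Coxeter system with length function $\ell$. For a word $Q=q_1q_2\cdots q_m$ in the letters $S$ and $\rho\in W$, write $[m]=\{1,\dots,m\}$. The subword complex $\mathcal{SC}(Q,\rho)$ is the simplicial complex whose facets are the sets $I\subseteq[m]$ such that the letters of $Q$ at the positions in $[m]\setminus I$, read in increasing order of position, form a reduced expression of $\rho$. Two distinct facets $I,J$ are adjacent if $I\setminus\{i\}=J\setminus\{j\}$ for some $i\in I$, $j\in J$; the flip from $I$ to $J$ is increasing if $i<j$. The increasing flip graph $\mathcal G(Q,\rho)$ is the directed graph whose vertices are the facets and whose edges $I\to J$ are the increasing flips. For an edge $I\to J$ with $I\setminus\{i\}=J\setminus\{j\}$, $i<j$, set $\mathsf n(I\to J)=j$. A path is $\mathsf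 n$-rising if the sequence of $\mathsf n$-labels of its successive edges is strictly increasing. When $\mathcal{SC}(Q,\rho)$ is non-empty, the negative greedy facet $\mathsf N(Q,\rho)$ is the unique sink of $\mathcal G(Q,\rho)$ (equivalently the lexicographically largest facet), and the negative sink tree $\mathcal N^*(Q,\rho)$ is the spanning tree of $\mathcal G(Q,\rho)$, directed towards $\mathsf N(Q,\rho)$, formed by all $\mathsf n$-rising paths from the facets of $\mathcal{SC}(Q,\rho)$ to $\mathsf N(Q,\rho)$ (there is exactly one such path from each facet). When $\mathcal{SC}(Q,\rho)$ has no facets, $\mathcal N^*(Q,\rho)$ is the empty tree. For a directed tree $\mathcal T$ whose vertices are subsets of $\mathbb Z$ and $z\in\mathbb Z$, $\mathcal T\star z$ denotes the tree with a vertex $X\cup\{z\}$ for each vertex $X$ of $\mathcal T$ and an edge $X\cup\{z\}\to Y\cup\{z\}$ for each edge $X\to Y$ of $\mathcal T$. -}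

module Defs where

open import Algebra.Bundles using (Group)
open import Data.Fin.Base using (Fin; fromℕ; _<_)
open import Data.Fin.Subset using (Subset; inside; outside; _∈_; _∪_; _-_; ⁅_⁆)
open import Data.List.Base using (List; []; _∷_; _++_; concat; replicate; length; foldr)
import Data.List.Membership.Propositional as ListMembership
open import Data.List.Relation.Unary.Linked using (Linked)
open import Data.Nat.Base as ℕ using (ℕ; suc)
open import Data.Product.Base using (Σ-syntax; ∃-syntax; _×_; _,_)
open import Data.Sum.Base using (_⊎_)
open import Data.Vec.Base using (Vec; []; _∷_; _∷ʳ_)
open import Function.Bundles using (_⇔_; Bijection)
open import Level using (Level; _⊔_) renaming (suc to lsuc)
open import Relation.Binary.Construct.Closure.Equivalence using (EqClosure)
open import Relation.Binary.Construct.Closure.ReflexiveTransitive using (Star; _◅_) renaming (ε to nil)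
open import Relation.Binary.PropositionalEquality using (_≡_; _≢_)
import Relation.Binary.PropositionalEquality as ≡
open import Relation.Nullary.Negation using (¬_)

------------------------------------------------------------------------
-- Coxeter systems

-- The entry 0 stands for ∞, so that the relator (s t)^0 is empty and
-- imposes nothing.
record CoxeterMatrix (n : ℕ) : Set where
  field
    order     : Fin n → Fin n → ℕ
    symmetric : ∀ s t → order s t ≡ order t s
    diagonal  : ∀ s → order s s ≡ 1
    offDiag   : ∀ s t → s ≢ t → order s t ≢ 1

module _ {n : ℕ} (M : CoxeterMatrix n) where
  open CoxeterMatrix M

  relator : Fin n → Fin n → List (Fin n)
  relator s t = concat (replicate (order s t) (s ∷ t ∷ []))

  data InsertRelator : List (Fin n) → List (Fin n) → Set where
    insert : ∀ u v s t → InsertRelator (u ++ v) (u ++ relator s t ++ v)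

  -- The relators s s make every generator its own inverse, so the monoid
  -- presented by this congruence is the group ⟨ S ∣ (s t)^order s t ⟩.
  CoxeterCongruence : List (Fin n) → List (Fin n) → Set
  CoxeterCongruence = EqClosure InsertRelator

-- S is indexed by Fin rank, and a word is a list of indices.
record FiniteCoxeterSystem (c ℓ : Level) : Set (lsuc (c ⊔ ℓ)) where
  field
    group : Group c ℓ
  open Group group public hiding (_-_)
  field
    rank      : ℕ
    matrix    : CoxeterMatrix rank
    generator : Fin rank → Carrier

  S : Set
  S = Fin rank

  eval : List S → Carrier
  eval = foldr (λ s w → generator s ∙ w) ε

  field
    generates   : ∀ w → ∃[ u ] eval u ≈ w
    presented   : ∀ u v → eval u ≈ eval v ⇔ CoxeterCongruence matrix u v
    cardinality : ℕ
    finite      : Bijection (≡.setoid (Fin cardinality)) setoid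

------------------------------------------------------------------------
-- Directed graphs on a fixed type of potential vertices

record Digraph (V : Set) (ℓ : Level) : Set (lsuc ℓ) where
  field
    Vertex : V → Set ℓ
    Edge   : V → V → Set ℓ
open Digraph public

module _ {V : Set} {ℓ : Level} where

  infix 4 _≐_

  _≐_ : Digraph V ℓ → Digraph V ℓ → Set ℓ
  G ≐ H = (∀ X → Vertex G X ⇔ Vertex H X) × (∀ X Y → Edge G X Y ⇔ Edge H X Y)

  Disjoint : Digraph V ℓ → Digraph V ℓ → Set ℓ
  Disjoint G H = ∀ X → ¬ (Vertex G X × Vertex H X)

  union : Digraph V ℓ → Digraph V ℓ → Digraph V ℓ
  union G H .Vertex X = Vertex G X ⊎ Vertex H X
  union G H .Edge X Y = Edge G X Y ⊎ Edge H X Y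

  addEdge : Digraph V ℓ → V → V → Digraph V ℓ
  addEdge G A B .Vertex X = Vertex G X
  addEdge G A B .Edge X Y = Edge G X Y ⊎ (X ≡ A × Y ≡ B)

  IsSink : Digraph V ℓ → V → Set ℓ
  IsSink G X = Vertex G X × (∀ Y → ¬ Edge G X Y)

  IsUniqueSink : Digraph V ℓ → V → Set ℓ
  IsUniqueSink G X = IsSink G X × (∀ Y → IsSink G Y → Y ≡ X)

  image : {V′ : Set} → (V → V′) → Digraph V ℓ → Digraph V′ ℓ
  image f G .Vertex X′ = ∃[ X ] Vertex G X × X′ ≡ f X
  image f G .Edge X′ Y′ =
    ∃[ X ] ∃[ Y ] Edge G X Y × X′ ≡ f X × Y′ ≡ f Y

-- [m] is Fin m, with positions counted from 0.  A subset of [m - 1] is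
-- regarded as a subset of [m] through widen, and the position m is last.

widen : ∀ {m} → Subset m → Subset (suc m)
widen I = I ∷ʳ outside

last : ∀ {m} → Fin (suc m)
last {m} = fromℕ m

widenGraph : ∀ {m ℓ} → Digraph (Subset m) ℓ → Digraph (Subset (suc m)) ℓ
widenGraph = image widen

infixl 6 _⋆_

_⋆_ : ∀ {m ℓ} → Digraph (Subset m) ℓ → Fin m → Digraph (Subset m) ℓ
T ⋆ z = image (λ X → X ∪ ⁅ z ⁆) T

------------------------------------------------------------------------
-- Subword complexes

-- The letters at the positions outside the given subset, in order.
complementWord : ∀ {A : Set} {m} → Vec A m → Subset m → List A
complementWord []      []            = []
complementWord (q ∷ Q) (inside  ∷ I) = complementWord Q I
complementWord (q ∷ Q) (outside ∷ I) = q ∷ complementWord Q I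

module SubwordComplex {c ℓ : Level} (W : FiniteCoxeterSystem c ℓ) where
  open FiniteCoxeterSystem W

  IsReducedExpression : List S → Carrier → Set ℓ
  IsReducedExpression u w =
    eval u ≈ w × (∀ v → eval v ≈ w → length u ℕ.≤ length v)

  module _ {m : ℕ} (Q : Vec S m) (ρ : Carrier) where

    Facet : Subset m → Set ℓ
    Facet I = IsReducedExpression (complementWord Q I) ρ

    record IncreasingFlip (I J : Subset m) : Set ℓ where
      field
        facetˡ   : Facet I
        facetʳ   : Facet J
        distinct : I ≢ J
        i j      : Fin m
        i∈I      : i ∈ I
        j∈J      : j ∈ J
        adjacent : I - i ≡ J - j
        i<j      : i < j

    increasingFlipGraph : Digraph (Subset m) ℓ
    increasingFlipGraph .Vertex = Facet
    increasingFlipGraph .Edge   = IncreasingFlip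

    Path : Subset m → Subset m → Set ℓ
    Path = Star IncreasingFlip

    nLabels : ∀ {I J} → Path I J → List (Fin m)
    nLabels nil     = []
    nLabels (e ◅ p) = IncreasingFlip.j e ∷ nLabels p

    edges : ∀ {I J} → Path I J → List (Subset m × Subset m)
    edges nil                       = []
    edges (_◅_ {i = I} {j = J} e p) = (I , J) ∷ edges p

    NRising : ∀ {I J} → Path I J → Set
    NRising p = Linked _<_ (nLabels p)

    IsNegativeGreedyFacet : Subset m → Set ℓ
    IsNegativeGreedyFacet = IsUniqueSink increasingFlipGraph

    -- The tree is spanning, so its vertices are all the facets; its edges are
    -- those traversed by some n-rising path from a facet to the negative
    -- greedy facet.  Without facets it is the empty graph.
    negativeSinkTree : Digraph (Subset m) ℓ
    negativeSinkTree .Vertex = Facet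
    negativeSinkTree .Edge X Y =
      ∃[ I ] ∃[ N ] Facet I × IsNegativeGreedyFacet N ×
        (Σ[ p ∈ Path I N ] NRising p × (X , Y) ListMembership.∈ edges p)

{-# OPTIONS --safe #-}

-- Each reflection occurs an even number of times among the inversions of a
-- relator, so the parity with which it occurs in a word depends only on the
-- element written, and this gives the exchange property.  By exchange, a facet
-- is a sink of the flip graph exactly if its complement is obtained by reading Q
-- from the left and using every left descent met, so sinks are unique.
--
-- The last position m splits the facets of SC(Q,ρ) into those of SC(Q⊣,ρ q) and
-- those of SC(Q⊣,ρ) joined with m.  An increasing flip between the two parts adds
-- m, hence has the largest label and ends every n-rising path.  The greedy
-- readings of ρ q and ρ, run in parallel, differ in exactly one letter, so one
-- such flip leads from N(Q⊣,ρ q) to N(Q⊣,ρ) ∪ {m}; it is the only one ending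
-- there, because deleting different letters of a reduced word gives different
-- elements.
module Submission where

open import Defs
open import Data.Bool.Base using (Bool; true; false; _xor_)
open import Data.Bool.Properties using (xor-assoc; xor-same; xor-comm; xor-identityʳ; ∨-identityʳ)
open import Data.Fin.Base as Fin using (Fin; zero; suc; inject₁)
import Data.Fin.Properties as Fin
open import Data.Fin.Subset using (Subset; inside; outside; _∈_; _∉_; _∪_; _-_; ⁅_⁆)
open import Data.Fin.Subset.Properties using (p─⊥≡p; anySubset?)
open import Data.List.Base using (List; []; _∷_; _++_; [_]; length; map; concat; replicate)
open import Data.List.Membership.Propositional using () renaming (_∈_ to _∈ˡ_)
open import Data.List.Membership.Propositional.Properties using (∈-map⁺; ∈-map⁻; ∈-++⁻; ∈-++⁺ˡ)
open import Data.List.Properties using (length-++; ++-identityʳ)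
open import Data.List.Relation.Unary.All as All using (All; []; _∷_)
import Data.List.Relation.Unary.All.Properties as All
open import Data.List.Relation.Unary.Any using (here)
open import Data.List.Relation.Unary.Linked as Linked using (Linked; []; [-]; _∷_)
import Data.List.Relation.Unary.Linked.Properties as Linked
open import Data.Nat.Base as ℕ using (ℕ; zero; suc; _≤_; _<_; z≤n; z<s; s<s; s<s⁻¹; s≤s⁻¹)
import Data.Nat.Properties as ℕ
open import Data.Product.Base as Product using (∃-syntax; Σ-syntax; _×_; _,_; proj₁; proj₂)
open import Data.Sum.Base as Sum using (_⊎_; inj₁; inj₂)
open import Data.Vec.Base as Vec using (Vec; []; _∷_; _∷ʳ_; here; there)
open import Data.Vec.Properties using (∷ʳ-injective; ∷ʳ-injectiveˡ; ∷ʳ-injectiveʳ)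
open import Function.Base using (_∘_)
open import Function.Bundles using (Bijection; Equivalence; mk⇔; _⇔_)
open import Level using (Level; _⊔_)
import Relation.Binary.Construct.Closure.Equivalence as EqClosure
open import Relation.Binary.Construct.Closure.ReflexiveTransitive using (_◅_; _◅◅_) renaming (ε to nil)
open import Relation.Binary.PropositionalEquality as ≡ using (_≡_; _≢_; module ≡-Reasoning)
import Relation.Binary.Reasoning.Setoid as SetoidReasoning
open import Relation.Nullary.Decidable using (Dec; yes; no; does; map′; does-⇔; _×-dec_; dec-true)
open import Relation.Nullary.Negation using (¬_; contradiction)

-- Parities of sums over an initial segment.

xorSum : ℕ → (ℕ → Bool) → Bool
xorSum zero    f = false
xorSum (suc n) f = f 0 xor xorSum n (f ∘ suc)

xorSum-cong : ∀ n {f g} → (∀ j → f j ≡ g j) → xorSum n f ≡ xorSum n g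
xorSum-cong zero    f≗g = ≡.refl
xorSum-cong (suc n) f≗g = ≡.cong₂ _xor_ (f≗g 0) (xorSum-cong n (f≗g ∘ suc))

xorSum-+ : ∀ m n f → xorSum (m ℕ.+ n) f ≡ xorSum m f xor xorSum n (f ∘ (m ℕ.+_))
xorSum-+ zero    n f = ≡.refl
xorSum-+ (suc m) n f =
  ≡.trans (≡.cong (f 0 xor_) (xorSum-+ m n (f ∘ suc))) (≡.sym (xor-assoc (f 0) _ _))

xorSum-periodic : ∀ n f → (∀ j → f (n ℕ.+ j) ≡ f j) → xorSum (n ℕ.+ n) f ≡ false
xorSum-periodic n f periodic = begin
  xorSum (n ℕ.+ n) f                         ≡⟨ xorSum-+ n n f ⟩
  xorSum n f xor xorSum n (f ∘ (n ℕ.+_))     ≡⟨ ≡.cong (xorSum n f xor_) (xorSum-cong n periodic) ⟩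
  xorSum n f xor xorSum n f                  ≡⟨ xor-same (xorSum n f) ⟩
  false                                      ∎
  where open ≡-Reasoning

-- Decidable equality and the quadratic relations.

module CoxeterTheory {c ℓ : Level} (W : FiniteCoxeterSystem c ℓ) where
  open FiniteCoxeterSystem W
  open CoxeterMatrix matrix
  open SubwordComplex W
  open SetoidReasoning setoid

  private
    g : S → Carrier
    g = generator

  infix 4 _≟_
  abstract
    -- Finiteness enters here: the enumeration reduces equality of elements to equality of indices,
    -- so that occurrences of a reflection can be counted by booleans.
    _≟_ : ∀ x y → Dec (x ≈ y)
    x ≟ y with strictlySurjective x | strictlySurjective y
      where open Bijection finite
    ... | a , a↦x | b , b↦y =
      map′ (λ a≡b → trans (sym a↦x) (trans (Bijection.cong finite a≡b) b↦y))
           (λ x≈y → Bijection.injective finite (trans a↦x (trans x≈y (sym b↦y))))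
           (a Fin.≟ b)

  eval-++ : ∀ u v → eval (u ++ v) ≈ eval u ∙ eval v
  eval-++ []      v = sym (identityˡ _)
  eval-++ (s ∷ u) v = trans (∙-congˡ (eval-++ u v)) (sym (assoc _ _ _))

  eval-∷ʳ : ∀ u s → eval (u ++ [ s ]) ≈ eval u ∙ g s
  eval-∷ʳ u s = trans (eval-++ u [ s ]) (∙-congˡ (identityʳ _))

  -- Inserting the relator into the empty word is a single step of the presenting congruence.
  eval-relator : ∀ s t → eval (relator matrix s t) ≈ ε
  eval-relator s t = Equivalence.from (presented (relator matrix s t) [])
    (EqClosure.symmetric _ (≡.subst (CoxeterCongruence matrix []) (++-identityʳ _)
      (EqClosure.return (insert [] [] s t))))

  involutive : ∀ s → g s ∙ g s ≈ ε
  involutive s = begin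
    g s ∙ g s                  ≈⟨ ∙-congˡ (identityʳ _) ⟨
    eval (s ∷ s ∷ [])          ≡⟨ ≡.cong (λ k → eval (concat (replicate k (s ∷ s ∷ [])))) (diagonal s) ⟨
    eval (relator matrix s s)  ≈⟨ eval-relator s s ⟩
    ε                          ∎

  cancelˡ : ∀ s x → g s ∙ (g s ∙ x) ≈ x
  cancelˡ s x = trans (sym (assoc _ _ _)) (trans (∙-congʳ (involutive s)) (identityˡ x))

  cancelʳ : ∀ s x → (x ∙ g s) ∙ g s ≈ x
  cancelʳ s x = trans (assoc _ _ _) (trans (∙-congˡ (involutive s)) (identityʳ x))

  -- Conjugation, and the parity of a reflection in a word.

  conj : S → Carrier → Carrier
  conj s x = g s ∙ (x ∙ g s)

  conj-cong : ∀ s {x y} → x ≈ y → conj s x ≈ conj s y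
  conj-cong s x≈y = ∙-congˡ (∙-congʳ x≈y)

  conj-involutive : ∀ s x → conj s (conj s x) ≈ x
  conj-involutive s x = begin
    g s ∙ ((g s ∙ (x ∙ g s)) ∙ g s)  ≈⟨ ∙-congˡ (assoc _ _ _) ⟩
    g s ∙ (g s ∙ ((x ∙ g s) ∙ g s))  ≈⟨ cancelˡ s _ ⟩
    (x ∙ g s) ∙ g s                  ≈⟨ cancelʳ s x ⟩
    x                                ∎

  conj-generator : ∀ s → conj s (g s) ≈ g s
  conj-generator s = trans (∙-congˡ (involutive s)) (identityʳ _)

  conj⇔ : ∀ s {x y} → x ≈ conj s y ⇔ conj s x ≈ y
  conj⇔ s = mk⇔ (λ p → trans (conj-cong s p) (conj-involutive s _))
                (λ p → trans (sym (conj-involutive s _)) (conj-cong s p))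

  -- This is w⁻¹ x w for w = `eval u`, computed letter by letter to match the recursion of `parity`.
  conjWord : List S → Carrier → Carrier
  conjWord []      x = x
  conjWord (s ∷ u) x = conjWord u (conj s x)

  eval-conjWord : ∀ u x → eval u ∙ conjWord u x ≈ x ∙ eval u
  eval-conjWord []      x = trans (identityˡ x) (sym (identityʳ x))
  eval-conjWord (s ∷ u) x = begin
    (g s ∙ eval u) ∙ conjWord u (conj s x)  ≈⟨ assoc _ _ _ ⟩
    g s ∙ (eval u ∙ conjWord u (conj s x))  ≈⟨ ∙-congˡ (eval-conjWord u (conj s x)) ⟩
    g s ∙ ((g s ∙ (x ∙ g s)) ∙ eval u)      ≈⟨ ∙-congˡ (assoc _ _ _) ⟩
    g s ∙ (g s ∙ ((x ∙ g s) ∙ eval u))      ≈⟨ cancelˡ s _ ⟩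
    (x ∙ g s) ∙ eval u                      ≈⟨ assoc _ _ _ ⟩
    x ∙ (g s ∙ eval u)                      ∎

  conjWord-trivial : ∀ u → eval u ≈ ε → ∀ x → conjWord u x ≈ x
  conjWord-trivial u u≈ε x = begin
    conjWord u x           ≈⟨ identityˡ _ ⟨
    ε ∙ conjWord u x       ≈⟨ ∙-congʳ u≈ε ⟨
    eval u ∙ conjWord u x  ≈⟨ eval-conjWord u x ⟩
    x ∙ eval u             ≈⟨ ∙-congˡ u≈ε ⟩
    x ∙ ε                  ≈⟨ identityʳ x ⟩
    x                      ∎

  -- For u = s₁⋯sₖ this is the parity of the number of j with
  -- x = s₁⋯sⱼ₋₁ sⱼ sⱼ₋₁⋯s₁.
  parity : List S → Carrier → Bool
  parity []      x = false
  parity (s ∷ u) x = does (x ≟ g s) xor parity u (conj s x)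

  parity-cong : ∀ u {x y} → x ≈ y → parity u x ≡ parity u y
  parity-cong []      x≈y = ≡.refl
  parity-cong (s ∷ u) x≈y = ≡.cong₂ _xor_
    (does-⇔ (mk⇔ (trans (sym x≈y)) (trans x≈y)) (_ ≟ _) (_ ≟ _))
    (parity-cong u (conj-cong s x≈y))

  parity-++ : ∀ u v x → parity (u ++ v) x ≡ parity u x xor parity v (conjWord u x)
  parity-++ []      v x = ≡.refl
  parity-++ (s ∷ u) v x =
    ≡.trans (≡.cong (does (x ≟ g s) xor_) (parity-++ u v (conj s x)))
            (≡.sym (xor-assoc (does (x ≟ g s)) _ _))

  private
    rep : ℕ → S → S → List S
    rep k s t = concat (replicate k (s ∷ t ∷ []))

    -- The element (s t)ʲ s.
    alternating : S → S → ℕ → Carrier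
    alternating s t zero    = g s
    alternating s t (suc j) = g s ∙ (g t ∙ alternating s t j)

    -- Both sides are the same alternating product, extended by two letters on the left or on the
    -- right.
    alternating-∷ʳ : ∀ s t j →
      g s ∙ (g t ∙ alternating s t j) ≈ (alternating s t j ∙ g t) ∙ g s
    alternating-∷ʳ s t zero    = sym (assoc _ _ _)
    alternating-∷ʳ s t (suc j) = begin
      g s ∙ (g t ∙ (g s ∙ (g t ∙ a)))    ≈⟨ ∙-congˡ (∙-congˡ (alternating-∷ʳ s t j)) ⟩
      g s ∙ (g t ∙ ((a ∙ g t) ∙ g s))    ≈⟨ ∙-congˡ (assoc _ _ _) ⟨
      g s ∙ ((g t ∙ (a ∙ g t)) ∙ g s)    ≈⟨ assoc _ _ _ ⟨
      (g s ∙ (g t ∙ (a ∙ g t))) ∙ g s    ≈⟨ ∙-congʳ (∙-congˡ (assoc _ _ _)) ⟨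
      (g s ∙ ((g t ∙ a) ∙ g t)) ∙ g s    ≈⟨ ∙-congʳ (assoc _ _ _) ⟨
      ((g s ∙ (g t ∙ a)) ∙ g t) ∙ g s    ∎
      where a = alternating s t j

    conj-alternating : ∀ s t j →
      conj s (conj t (alternating s t j)) ≈ alternating s t (2 ℕ.+ j)
    conj-alternating s t j = begin
      g s ∙ ((g t ∙ (a ∙ g t)) ∙ g s)    ≈⟨ ∙-congˡ (assoc _ _ _) ⟩
      g s ∙ (g t ∙ ((a ∙ g t) ∙ g s))    ≈⟨ ∙-congˡ (∙-congˡ (alternating-∷ʳ s t j)) ⟨
      g s ∙ (g t ∙ (g s ∙ (g t ∙ a)))    ∎
      where a = alternating s t j

    alternating-+ : ∀ s t k j →
      alternating s t (k ℕ.+ j) ≈ eval (rep k s t) ∙ alternating s t j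
    alternating-+ s t zero    j = sym (identityˡ _)
    alternating-+ s t (suc k) j = begin
      g s ∙ (g t ∙ alternating s t (k ℕ.+ j))  ≈⟨ ∙-congˡ (∙-congˡ (alternating-+ s t k j)) ⟩
      g s ∙ (g t ∙ (r ∙ a))                    ≈⟨ ∙-congˡ (assoc _ _ _) ⟨
      g s ∙ ((g t ∙ r) ∙ a)                    ≈⟨ assoc _ _ _ ⟨
      (g s ∙ (g t ∙ r)) ∙ a                    ∎
      where a = alternating s t j
            r = eval (rep k s t)

    -- The first factor s t accounts for the indices 0 and 1; conjugation by its two letters shifts
    -- the remaining indices by 2.
    parity-rep : ∀ k s t x →
      parity (rep k s t) x ≡ xorSum (k ℕ.* 2) (λ j → does (x ≟ alternating s t j))
    parity-rep zero    s t x = ≡.refl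
    parity-rep (suc k) s t x = ≡.cong (does (x ≟ g s) xor_) (≡.cong₂ _xor_
      (does-⇔ (mk⇔ (λ p → trans (Equivalence.from (conj⇔ s) p) ≈₁)
                   (λ p → Equivalence.to (conj⇔ s) (trans p (sym ≈₁)))) (_ ≟ _) (_ ≟ _))
      (≡.trans (parity-rep k s t _) (xorSum-cong (k ℕ.* 2) λ j →
        does-⇔ (mk⇔
          (λ p → trans (Equivalence.from (conj⇔ s) (Equivalence.from (conj⇔ t) p)) (conj-alternating s t j))
          (λ p → Equivalence.to (conj⇔ t) (Equivalence.to (conj⇔ s) (trans p (sym (conj-alternating s t j))))))
          (_ ≟ _) (_ ≟ _))))
      where
      ≈₁ : conj s (g t) ≈ alternating s t 1
      ≈₁ = refl

  -- The reflections of (s t)ᵐ are (s t)ʲ s for 0 ≤ j < 2m, which has period m.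
  parity-relator : ∀ s t x → parity (relator matrix s t) x ≡ false
  parity-relator s t x = ≡.trans (parity-rep m s t x)
    (≡.trans (≡.cong (λ k → xorSum k f) m*2≡m+m)
      (xorSum-periodic m f λ j →
        does-⇔ (mk⇔ (λ p → trans p (period j)) (λ p → trans p (sym (period j)))) (_ ≟ _) (_ ≟ _)))
    where
    m = order s t
    f : ℕ → Bool
    f j = does (x ≟ alternating s t j)
    m*2≡m+m : m ℕ.* 2 ≡ m ℕ.+ m
    m*2≡m+m = ≡.trans (ℕ.*-comm m 2) (≡.cong (m ℕ.+_) (ℕ.+-identityʳ m))
    period : ∀ j → alternating s t (m ℕ.+ j) ≈ alternating s t j
    period j = trans (alternating-+ s t m j)
                     (trans (∙-congʳ (eval-relator s t)) (identityˡ _))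

  -- The relator contributes an even count itself, and since it evaluates to `ε` it does not change
  -- the reflection counted in the letters after it.
  parity-insert : ∀ {u v} → InsertRelator matrix u v → ∀ x → parity u x ≡ parity v x
  parity-insert (insert u v s t) x = ≡.sym (≡.trans (parity-++ u (r ++ v) x)
    (≡.trans (≡.cong (parity u x xor_) inner) (≡.sym (parity-++ u v x))))
    where
    r = relator matrix s t
    y = conjWord u x
    inner : parity (r ++ v) y ≡ parity v y
    inner = ≡.trans (parity-++ r v y) (≡.cong₂ _xor_ (parity-relator s t y)
      (parity-cong v (conjWord-trivial r (eval-relator s t) y)))

  -- By the presentation, two words for one element are linked by insertions and removals of
  -- relators, none of which changes a parity.
  parity-respects-eval : ∀ u v → eval u ≈ eval v → ∀ x → parity u x ≡ parity v x
  parity-respects-eval u v u≈v =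
    EqClosure.gfold {S = λ (f h : Carrier → Bool) → ∀ x → f x ≡ h x}
      (record { refl  = λ _ → ≡.refl
              ; sym   = λ p x → ≡.sym (p x)
              ; trans = λ p q x → ≡.trans (p x) (q x) })
      parity parity-insert (Equivalence.to (presented u v) u≈v)

  -- Deletions, the length function and the exchange property.

  data Deletion : List S → List S → Set where
    here  : ∀ {s u} → Deletion (s ∷ u) u
    there : ∀ {s u v} → Deletion u v → Deletion (s ∷ u) (s ∷ v)

  length-deletion : ∀ {u v} → Deletion u v → length u ≡ suc (length v)
  length-deletion here      = ≡.refl
  length-deletion (there d) = ≡.cong suc (length-deletion d)

  -- An odd count is not zero, so x = p s p⁻¹ for some prefix p of u followed by the letter s.
  -- Multiplying p s r by x on the left then gives p r.
  odd⇒deletion : ∀ u x → parity u x ≡ true →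
    ∃[ v ] Deletion u v × eval v ≈ x ∙ eval u
  odd⇒deletion (s ∷ u) x odd with x ≟ g s
  ... | yes x≈s = u , here , sym (trans (∙-congʳ x≈s) (cancelˡ s _))
  ... | no  _   with odd⇒deletion u (conj s x) odd
  ...   | v , d , v≈ = s ∷ v , there d , (begin
    g s ∙ eval v                        ≈⟨ ∙-congˡ v≈ ⟩
    g s ∙ ((g s ∙ (x ∙ g s)) ∙ eval u)  ≈⟨ ∙-congˡ (assoc _ _ _) ⟩
    g s ∙ (g s ∙ ((x ∙ g s) ∙ eval u))  ≈⟨ cancelˡ s _ ⟩
    (x ∙ g s) ∙ eval u                  ≈⟨ assoc _ _ _ ⟩
    x ∙ (g s ∙ eval u)                  ∎)

  private
    ofLength? : ∀ k w → Dec (∃[ u ] length u ≡ k × eval u ≈ w)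
    ofLength? zero    w = map′ (λ p → [] , ≡.refl , p) (λ { ([] , _ , p) → p }) (ε ≟ w)
    ofLength? (suc k) w = map′
      (λ { (s , u , ≡.refl , p) → s ∷ u , ≡.refl , trans (∙-congˡ p) (cancelˡ s w) })
      (λ { (s ∷ u , ≡.refl , p) → s , u , ≡.refl , trans (sym (cancelˡ s _)) (∙-congˡ p) })
      (Fin.any? λ s → ofLength? k (g s ∙ w))

    -- A search by increasing length: as long as nothing is found, all lengths below k are excluded.
    shortest : ∀ k w → (∃[ u ] IsReducedExpression u w) ⊎ (∀ v → eval v ≈ w → k ≤ length v)
    shortest zero    w = inj₂ λ _ _ → z≤n
    shortest (suc k) w with shortest k w
    ... | inj₁ r = inj₁ r
    ... | inj₂ k≤ with ofLength? k w
    ...   | yes (u , ≡.refl , u≈w) = inj₁ (u , u≈w , k≤)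
    ...   | no none = inj₂ λ v v≈w →
              ℕ.≤∧≢⇒< (k≤ v v≈w) λ k≡ → none (v , ≡.sym k≡ , v≈w)

  abstract
    reducedExpression : ∀ w → ∃[ u ] IsReducedExpression u w
    reducedExpression w with generates w
    -- The word u refutes the lower bound `suc (length u)`, so the search has succeeded by then.
    ... | u , u≈w with shortest (suc (length u)) w
    ...   | inj₁ r = r
    ...   | inj₂ k≤ = contradiction (k≤ u u≈w) (ℕ.<-irrefl ≡.refl)

  abstract
    -- The reduced expression chosen may depend on the representative of w; `len-cong` shows that
    -- its length depends only on the class under `≈`.
    len : Carrier → ℕ
    len w = length (proj₁ (reducedExpression w))

    length-reduced : ∀ u {w} → IsReducedExpression u w → length u ≡ len w
    length-reduced u {w} (u≈w , min) with reducedExpression w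
    ... | v , v≈w , min′ = ℕ.≤-antisym (min v v≈w) (min′ u u≈w)

  len-≤ : ∀ {w} u → eval u ≈ w → len w ≤ length u
  len-≤ {w} u u≈w with reducedExpression w
  ... | v , r = ≡.subst (_≤ length u) (length-reduced v r) (proj₂ r u u≈w)

  len-cong : ∀ {x y} → x ≈ y → len x ≡ len y
  len-cong x≈y = ℕ.≤-antisym (half x≈y) (half (sym x≈y))
    where
    half : ∀ {x y} → x ≈ y → len x ≤ len y
    half {x} {y} x≈y with reducedExpression y
    ... | u , r@(u≈y , _) =
      ≡.subst (len x ≤_) (length-reduced u r) (len-≤ u (trans u≈y (sym x≈y)))

  reduced : ∀ u {w} → eval u ≈ w → length u ≤ len w → IsReducedExpression u w
  reduced u u≈w u≤ = u≈w , λ v v≈w → ℕ.≤-trans u≤ (len-≤ v v≈w)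

  reduced? : ∀ u w → Dec (IsReducedExpression u w)
  reduced? u w = map′ (λ { (p , q) → reduced u p q })
    (λ r → proj₁ r , ℕ.≤-reflexive (length-reduced u r))
    (eval u ≟ w ×-dec length u ℕ.≤? len w)

  len-∙ˡ : ∀ s w → len (g s ∙ w) ≤ suc (len w)
  len-∙ˡ s w with reducedExpression w
  ... | u , r@(u≈w , _) = ≡.subst (λ k → len (g s ∙ w) ≤ suc k) (length-reduced u r)
    (len-≤ (s ∷ u) (∙-congˡ u≈w))

  len-∙ʳ : ∀ w s → len (w ∙ g s) ≤ suc (len w)
  len-∙ʳ w s with reducedExpression w
  ... | u , r@(u≈w , _) = ≡.subst (len (w ∙ g s) ≤_)
    (≡.trans (length-++ u) (≡.trans (ℕ.+-comm (length u) 1) (≡.cong suc (length-reduced u r))))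
    (len-≤ (u ++ [ s ]) (trans (eval-∷ʳ u s) (∙-congʳ u≈w)))

  private
    -- If x had even parity in u, it would have odd parity in every word for
    -- y = x w; deleting a letter from a reduced one would then write w with
    -- fewer than len y ≤ len w letters.
    exchange : ∀ {u w x y v} → eval u ≈ w → x ∙ w ≈ y → x ∙ y ≈ w → len y ≤ len w →
      eval v ≈ y → parity v x ≡ true xor parity u x →
      ∃[ u′ ] Deletion u u′ × eval u′ ≈ y
    exchange {u} {w} {x} {y} {v} u≈w xw≈y xy≈w y≤w v≈y flips with parity u x in eq
    ... | true with odd⇒deletion u x eq
    ...   | u′ , d , u′≈ = u′ , d , trans u′≈ (trans (∙-congˡ u≈w) xw≈y)
    exchange {u} {w} {x} {y} {v} u≈w xw≈y xy≈w y≤w v≈y flips | false with reducedExpression y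
    ... | r , red@(r≈y , _) with odd⇒deletion r x (≡.trans (parity-respects-eval r v (trans r≈y (sym v≈y)) x) flips)
    ...   | r′ , d , r′≈ = contradiction
      (ℕ.≤-<-trans (ℕ.≤-trans y≤w (len-≤ r′ (trans r′≈ (trans (∙-congˡ r≈y) xy≈w))))
                   (ℕ.≤-reflexive (≡.sym (length-deletion d))))
      (ℕ.<-irrefl (≡.sym (length-reduced r red)))

  -- Here the reflection is s itself. Prefixing the letter s counts it once more, and conjugation by
  -- s fixes it, so its parity flips.
  exchangeˡ : ∀ u {w} s → eval u ≈ w → len (g s ∙ w) ≤ len w →
    ∃[ u′ ] Deletion u u′ × eval u′ ≈ g s ∙ w
  exchangeˡ u {w} s u≈w le =
    exchange {v = s ∷ u} u≈w refl (cancelˡ s w) le (∙-congˡ u≈w)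
      (≡.cong₂ _xor_ (dec-true (g s ≟ g s) refl) (parity-cong u (conj-generator s)))

  -- The reflection x = w s w⁻¹ turns right multiplication by s into left multiplication by x. Seen
  -- through the prefix u it becomes s, so the appended letter flips its parity.
  exchangeʳ : ∀ u {w} s → eval u ≈ w → len (w ∙ g s) ≤ len w →
    ∃[ u′ ] Deletion u u′ × eval u′ ≈ w ∙ g s
  exchangeʳ u {w} s u≈w le =
    exchange {x = x} {v = u ++ [ s ]} u≈w xw≈ws xws≈w le (trans (eval-∷ʳ u s) (∙-congʳ u≈w)) flips
    where
    x = (w ∙ g s) ∙ w ⁻¹
    xw≈ws : x ∙ w ≈ w ∙ g s
    xw≈ws = trans (assoc _ _ _) (trans (∙-congˡ (inverseˡ w)) (identityʳ _))
    xws≈w : x ∙ (w ∙ g s) ≈ w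
    xws≈w = trans (sym (assoc _ _ _)) (trans (∙-congʳ xw≈ws) (cancelʳ s w))
    conj≈s : conjWord u x ≈ g s
    conj≈s = begin
      conjWord u x                        ≈⟨ identityˡ _ ⟨
      ε ∙ conjWord u x                    ≈⟨ ∙-congʳ (inverseˡ (eval u)) ⟨
      (eval u ⁻¹ ∙ eval u) ∙ conjWord u x ≈⟨ assoc _ _ _ ⟩
      eval u ⁻¹ ∙ (eval u ∙ conjWord u x) ≈⟨ ∙-congˡ (eval-conjWord u x) ⟩
      eval u ⁻¹ ∙ (x ∙ eval u)            ≈⟨ ∙-congˡ (∙-congˡ u≈w) ⟩
      eval u ⁻¹ ∙ (x ∙ w)                 ≈⟨ ∙-congˡ xw≈ws ⟩
      eval u ⁻¹ ∙ (w ∙ g s)               ≈⟨ ∙-congˡ (∙-congʳ u≈w) ⟨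
      eval u ⁻¹ ∙ (eval u ∙ g s)          ≈⟨ assoc _ _ _ ⟨
      (eval u ⁻¹ ∙ eval u) ∙ g s          ≈⟨ ∙-congʳ (inverseˡ (eval u)) ⟩
      ε ∙ g s                             ≈⟨ identityˡ _ ⟩
      g s                                 ∎
    flips : parity (u ++ [ s ]) x ≡ true xor parity u x
    flips = ≡.trans (parity-++ u [ s ] x) (≡.trans (xor-comm (parity u x) _)
      (≡.cong (_xor parity u x) (≡.trans (xor-identityʳ _) (dec-true (_ ≟ _) conj≈s))))

-- Subsets with one position removed, and swaps of two positions.

-- An inductive form of `j ∈ J` together with `J - j ≡ I`, so that flips can be analysed one
-- position at a time.
data Drop : ∀ {m} → Subset m → Fin m → Subset m → Set where
  here  : ∀ {m} {I : Subset m} → Drop (inside ∷ I) zero (outside ∷ I)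
  there : ∀ {m b j} {I J : Subset m} → Drop J j I → Drop (b ∷ J) (suc j) (b ∷ I)

drop-∈ : ∀ {m j} {I J : Subset m} → Drop J j I → j ∈ J
drop-∈ here      = here
drop-∈ (there d) = there (drop-∈ d)

drop-≡ : ∀ {m j} {I J : Subset m} → Drop J j I → J - j ≡ I
drop-≡ here      = ≡.cong (outside ∷_) (p─⊥≡p _)
drop-≡ (there d) = ≡.cong (_ ∷_) (drop-≡ d)

∈⇒drop : ∀ {m j} {J : Subset m} → j ∈ J → Drop J j (J - j)
∈⇒drop {J = _ ∷ J} here = ≡.subst (λ K → Drop (inside ∷ J) zero (outside ∷ K)) (≡.sym (p─⊥≡p J)) here
∈⇒drop (there j∈J) = there (∈⇒drop j∈J)

drop-injective : ∀ {m i j} {I J : Subset m} → Drop J i I → Drop J j I → i ≡ j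
drop-injective here      here      = ≡.refl
drop-injective (there d) (there e) = ≡.cong suc (drop-injective d e)

drop-∷ʳ : ∀ {m j b} {I J : Subset m} → Drop J j I → Drop (J ∷ʳ b) (inject₁ j) (I ∷ʳ b)
drop-∷ʳ here      = here
drop-∷ʳ (there d) = there (drop-∷ʳ d)

drop-last : ∀ {m} (I : Subset m) → Drop (I ∷ʳ inside) last (I ∷ʳ outside)
drop-last []      = here
drop-last (b ∷ I) = there (drop-last I)

data DropView {m} (J : Subset m) : Bool → Fin (suc m) → Subset m → Bool → Set where
  dropInit : ∀ {I j b} → Drop J j I → DropView J b (inject₁ j) I b
  dropLast : DropView J inside last J outside

dropView : ∀ {m b c j} (J I : Subset m) → Drop (J ∷ʳ b) j (I ∷ʳ c) → DropView J b j I c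
dropView []      []      here      = dropLast
-- Matching `here` directly would have to unify `J ∷ʳ b` with `I ∷ʳ c`, so the tails are first
-- replaced by variables with equations.
dropView (_ ∷ J) (_ ∷ I) d         = ∷-view d ≡.refl ≡.refl
  where
  ∷-view : ∀ {a a′ b c j X Y} → Drop (a ∷ X) j (a′ ∷ Y) → X ≡ J ∷ʳ b → Y ≡ I ∷ʳ c →
           DropView (a ∷ J) b j (a′ ∷ I) c
  ∷-view {b = b} {c} here X≡ Y≡ with ∷ʳ-injective J I (≡.trans (≡.sym X≡) Y≡)
  ... | ≡.refl , ≡.refl = dropInit here
  ∷-view (there d) ≡.refl ≡.refl with dropView J I d
  ... | dropInit e = dropInit (there e)
  ... | dropLast   = dropLast

-- An increasing flip stripped of its facet conditions. The position that is added, which is the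
-- label of the flip, is an index.
record Swap {m} (I J : Subset m) (j : Fin m) : Set where
  constructor swap
  field
    {common} : Subset m
    {i}      : Fin m
    dropˡ    : Drop I i common
    dropʳ    : Drop J j common
    i<j      : i Fin.< j

swap-distinct : ∀ {m j} {I J : Subset m} → Swap I J j → I ≢ J
swap-distinct (swap d e i<j) ≡.refl = Fin.<-irrefl (drop-injective d e) i<j

inject₁-mono-< : ∀ {m} {i j : Fin m} → i Fin.< j → inject₁ i Fin.< inject₁ j
inject₁-mono-< {i = i} {j} = ≡.subst₂ _<_ (≡.sym (Fin.toℕ-inject₁ i)) (≡.sym (Fin.toℕ-inject₁ j))

inject₁-cancel-< : ∀ {m} {i j : Fin m} → inject₁ i Fin.< inject₁ j → i Fin.< j
inject₁-cancel-< {i = i} {j} = ≡.subst₂ _<_ (Fin.toℕ-inject₁ i) (Fin.toℕ-inject₁ j)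

inject₁<last : ∀ {m} (i : Fin m) → inject₁ i Fin.< last
inject₁<last {m} i = ≡.subst (Fin.toℕ (inject₁ i) <_) (≡.sym (Fin.toℕ-fromℕ m)) (Fin.inject₁ℕ< i)

last≮ : ∀ {m} (i : Fin (suc m)) → ¬ (last Fin.< i)
last≮ i = ℕ.≤⇒≯ (Fin.≤fromℕ i)

swap-∷ʳ : ∀ {m j b} {I J : Subset m} → Swap I J j → Swap (I ∷ʳ b) (J ∷ʳ b) (inject₁ j)
swap-∷ʳ (swap d e i<j) = swap (drop-∷ʳ d) (drop-∷ʳ e) (inject₁-mono-< i<j)

drop⇒swap-last : ∀ {m i} {I J : Subset m} → Drop I i J → Swap (widen I) (J ∷ʳ inside) last
drop⇒swap-last {i = i} {J = J} d = swap (drop-∷ʳ d) (drop-last J) (inject₁<last i)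

data SwapView {m} (I J : Subset m) : Bool → Bool → Fin (suc m) → Set where
  swapInit : ∀ {b j} → Swap I J j → SwapView I J b b (inject₁ j)
  swapLast : ∀ {i} → Drop I i J → SwapView I J outside inside last

-- Nothing lies beyond the last position, so an increasing flip can add it but never remove it.
swapView : ∀ {m b c j} (I J : Subset m) → Swap (I ∷ʳ b) (J ∷ʳ c) j → SwapView I J b c j
swapView I J (swap {K} d e i<j) with Vec.initLast K
... | K′ , _ , ≡.refl with dropView I K′ d | dropView J K′ e
...   | dropInit d′ | dropInit e′ = swapInit (swap d′ e′ (inject₁-cancel-< i<j))
...   | dropInit d′ | dropLast    = swapLast d′
...   | dropLast    | _           = contradiction i<j (last≮ _)

∪-last : ∀ {m} (I : Subset m) → widen I ∪ ⁅ last ⁆ ≡ I ∷ʳ inside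
∪-last []      = ≡.refl
∪-last (b ∷ I) = ≡.cong₂ _∷_ (∨-identityʳ b) (∪-last I)

last∈∷ʳ : ∀ {m b} (I : Subset m) → last ∈ I ∷ʳ b → b ≡ inside
last∈∷ʳ []      here      = ≡.refl
last∈∷ʳ (_ ∷ I) (there p) = last∈∷ʳ I p

complementWord-∷ʳ-inside : ∀ {A : Set} {m} (Q : Vec A m) q I →
  complementWord (Q ∷ʳ q) (I ∷ʳ inside) ≡ complementWord Q I
complementWord-∷ʳ-inside []      q []            = ≡.refl
complementWord-∷ʳ-inside (_ ∷ Q) q (inside ∷ I)  = complementWord-∷ʳ-inside Q q I
complementWord-∷ʳ-inside (p ∷ Q) q (outside ∷ I) = ≡.cong (p ∷_) (complementWord-∷ʳ-inside Q q I)

complementWord-∷ʳ-outside : ∀ {A : Set} {m} (Q : Vec A m) q I →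
  complementWord (Q ∷ʳ q) (I ∷ʳ outside) ≡ complementWord Q I ++ [ q ]
complementWord-∷ʳ-outside []      q []            = ≡.refl
complementWord-∷ʳ-outside (_ ∷ Q) q (inside ∷ I)  = complementWord-∷ʳ-outside Q q I
complementWord-∷ʳ-outside (p ∷ Q) q (outside ∷ I) = ≡.cong (p ∷_) (complementWord-∷ʳ-outside Q q I)

-- Descents, greedy readings and sinks of the flip graph.

module SinkTheory {c ℓ : Level} (W : FiniteCoxeterSystem c ℓ) where
  open FiniteCoxeterSystem W
  open SubwordComplex W
  open CoxeterTheory W

  private
    g : S → Carrier
    g = generator

  len-∙ˡ⁻ : ∀ s w → len w ≤ suc (len (g s ∙ w))
  len-∙ˡ⁻ s w = ≡.subst (_≤ suc (len (g s ∙ w))) (len-cong (cancelˡ s w)) (len-∙ˡ s (g s ∙ w))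

  len-∙ʳ⁻ : ∀ w s → len w ≤ suc (len (w ∙ g s))
  len-∙ʳ⁻ w s = ≡.subst (_≤ suc (len (w ∙ g s))) (len-cong (cancelʳ s w)) (len-∙ʳ (w ∙ g s) s)

  -- Equal lengths do not occur: if the length does not grow, exchange deletes a letter from a
  -- reduced word for w, and the result writes s w.
  descent? : ∀ s w → len (g s ∙ w) < len w ⊎ len w < len (g s ∙ w)
  descent? s w with len (g s ∙ w) ℕ.≤? len w | reducedExpression w
  ... | no  ≰ | _ = inj₂ (ℕ.≰⇒> ≰)
  ... | yes ≤w | u , r@(u≈w , _) with exchangeˡ u s u≈w ≤w
  ...   | v , d , v≈ = inj₁ (ℕ.≤-<-trans (len-≤ v v≈)
            (ℕ.≤-reflexive (≡.trans (≡.sym (length-deletion d)) (length-reduced u r))))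

  reduced-deletion : ∀ u v {x y} → IsReducedExpression u x → Deletion u v → eval v ≈ y →
    len x ≤ suc (len y) → IsReducedExpression v y
  reduced-deletion u v {y = y} r d v≈y x≤ = reduced v v≈y (s≤s⁻¹
    (≡.subst (_≤ suc (len y)) (≡.trans (≡.sym (length-reduced u r)) (length-deletion d)) x≤))

  reduced-tail : ∀ s u {w} → IsReducedExpression (s ∷ u) w →
    IsReducedExpression u (g s ∙ w) × len (g s ∙ w) < len w
  reduced-tail s u {w} r@(su≈w , _) = ru ,
    ≡.subst₂ _<_ (length-reduced u ru) (length-reduced (s ∷ u) r) ℕ.≤-refl
    where
    ru : IsReducedExpression u (g s ∙ w)
    ru = reduced-deletion (s ∷ u) u r here (trans (sym (cancelˡ s _)) (∙-congˡ su≈w)) (len-∙ˡ⁻ s w)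

  reduced-∷ : ∀ s u {w} → IsReducedExpression u (g s ∙ w) → len (g s ∙ w) < len w →
    IsReducedExpression (s ∷ u) w
  reduced-∷ s u {w} r lt = reduced (s ∷ u) (trans (∙-congˡ (proj₁ r)) (cancelˡ s w))
    (≡.subst (_< len w) (≡.sym (length-reduced u r)) lt)

  reduced-init : ∀ u {s w} → IsReducedExpression (u ++ [ s ]) w →
    IsReducedExpression u (w ∙ g s) × len (w ∙ g s) < len w
  reduced-init u {s} {w} r = ru ,
    ≡.subst₂ _<_ (length-reduced u ru) (length-reduced (u ++ [ s ]) r) (ℕ.≤-reflexive (≡.sym ∣u∷ʳs∣))
    where
    ∣u∷ʳs∣ : length (u ++ [ s ]) ≡ suc (length u)
    ∣u∷ʳs∣ = ≡.trans (length-++ u) (ℕ.+-comm (length u) 1)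
    ru : IsReducedExpression u (w ∙ g s)
    ru = reduced u (trans (sym (cancelʳ s _)) (∙-congʳ (trans (sym (eval-∷ʳ u s)) (proj₁ r))))
      (s≤s⁻¹ (≡.subst (_≤ suc (len (w ∙ g s))) (≡.trans (≡.sym (length-reduced (u ++ [ s ]) r)) ∣u∷ʳs∣) (len-∙ʳ⁻ w s)))

  reduced-∷ʳ : ∀ u {s w} → IsReducedExpression u (w ∙ g s) → len (w ∙ g s) < len w →
    IsReducedExpression (u ++ [ s ]) w
  reduced-∷ʳ u {s} {w} r lt = reduced (u ++ [ s ])
    (trans (eval-∷ʳ u s) (trans (∙-congʳ (proj₁ r)) (cancelʳ s w)))
    (≡.subst (_≤ len w) (≡.sym (≡.trans (length-++ u) (ℕ.+-comm (length u) 1)))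
      (≡.subst (_< len w) (≡.sym (length-reduced u r)) lt))

  -- Deleting a letter from the complement word means adding its position to the subset.
  deletion⇒drop : ∀ {m} (Q : Vec S m) I {v} → Deletion (complementWord Q I) v →
    ∃[ J ] complementWord Q J ≡ v × ∃[ j ] Drop J j I
  deletion⇒drop []      []           ()
  deletion⇒drop (q ∷ Q) (inside ∷ I) d with deletion⇒drop Q I d
  ... | J , eq , j , dr = inside ∷ J , eq , suc j , there dr
  deletion⇒drop (q ∷ Q) (outside ∷ I) here      = inside ∷ I , ≡.refl , zero , here
  deletion⇒drop (q ∷ Q) (outside ∷ I) (there d) with deletion⇒drop Q I d
  ... | J , eq , j , dr = outside ∷ J , ≡.cong (q ∷_) eq , suc j , there dr

  drop⇒deletion : ∀ {m j} (Q : Vec S m) {I J} → Drop J j I →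
    Deletion (complementWord Q I) (complementWord Q J)
  drop⇒deletion (q ∷ Q) here = here
  drop⇒deletion (q ∷ Q) (there {b = inside}  d) = drop⇒deletion Q d
  drop⇒deletion (q ∷ Q) (there {b = outside} d) = there (drop⇒deletion Q d)

  exchange-facet : ∀ {m} (Q : Vec S m) I {s w} → Facet Q w I → len (g s ∙ w) < len w →
    ∃[ J ] Facet Q (g s ∙ w) J × ∃[ j ] Drop J j I
  exchange-facet Q I {s} {w} f lt with exchangeˡ (complementWord Q I) s (proj₁ f) (ℕ.<⇒≤ lt)
  ... | v , d , v≈ with deletion⇒drop Q I d
  ...   | J , ≡.refl , dr = J , reduced-deletion (complementWord Q I) v f d v≈ (len-∙ˡ⁻ s w) , dr

  -- This serves to show that w s is shorter than w when facets for w s exist but facets for w do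
  -- not.
  exchange-facetʳ : ∀ {m} (Q : Vec S m) I {s w} → Facet Q (w ∙ g s) I → len w ≤ len (w ∙ g s) →
    ∃[ J ] Facet Q w J
  exchange-facetʳ Q I {s} {w} f le
    with exchangeʳ (complementWord Q I) s (proj₁ f) (≡.subst (_≤ len (w ∙ g s)) (≡.sym (len-cong (cancelʳ s w))) le)
  ... | v , d , v≈ with deletion⇒drop Q I d
  ...   | J , ≡.refl , _ = J , reduced-deletion (complementWord Q I) v f d (trans v≈ (cancelʳ s w)) (len-∙ʳ w s)

  -- A facet is a sink exactly if its complement is found by scanning Q from
  -- the left and using a letter whenever it is a left descent of what remains
  -- to be written.
  data Greedy : ∀ {m} → Vec S m → Carrier → Subset m → Set (c ⊔ ℓ) where
    []   : ∀ {w} → w ≈ ε → Greedy [] w []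
    take : ∀ {m q w I} {Q : Vec S m} → len (g q ∙ w) < len w →
           Greedy Q (g q ∙ w) I → Greedy (q ∷ Q) w (outside ∷ I)
    skip : ∀ {m q w I} {Q : Vec S m} → len w < len (g q ∙ w) →
           Greedy Q w I → Greedy (q ∷ Q) w (inside ∷ I)

  -- If the first letter is a descent that the facet leaves out, exchange yields a facet of the
  -- remaining word for q w. If it is an ascent, a reduced word cannot begin with it, so the facet
  -- leaves it out as well.
  greedy-exists : ∀ {m} (Q : Vec S m) I {w} → Facet Q w I → ∃[ J ] Greedy Q w J
  greedy-exists []      []      (ε≈w , _) = [] , [] (sym ε≈w)
  greedy-exists (q ∷ Q) (b ∷ I) {w} f with descent? q w | b
  ... | inj₁ lt | inside  with exchange-facet Q I f lt
  ...   | I′ , f′ , _ with greedy-exists Q I′ f′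
  ...     | J , gr = outside ∷ J , take lt gr
  greedy-exists (q ∷ Q) (b ∷ I) {w} f | inj₁ lt | outside
    with greedy-exists Q I (proj₁ (reduced-tail q (complementWord Q I) f))
  ... | J , gr = outside ∷ J , take lt gr
  greedy-exists (q ∷ Q) (b ∷ I) {w} f | inj₂ gt | inside
    with greedy-exists Q I f
  ... | J , gr = inside ∷ J , skip gt gr
  greedy-exists (q ∷ Q) (b ∷ I) {w} f | inj₂ gt | outside =
    contradiction (proj₂ (reduced-tail q (complementWord Q I) f)) (ℕ.<-asym gt)

  greedy⇒facet : ∀ {m} {Q : Vec S m} {w I} → Greedy Q w I → Facet Q w I
  greedy⇒facet ([] w≈ε)     = sym w≈ε , λ _ _ → z≤n
  greedy⇒facet {Q = q ∷ Q} {I = _ ∷ I} (take lt gr) = reduced-∷ q (complementWord Q I) (greedy⇒facet gr) lt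
  greedy⇒facet (skip gt gr) = greedy⇒facet gr

  greedy-unique : ∀ {m} {Q : Vec S m} {v w I J} → v ≈ w → Greedy Q v I → Greedy Q w J → I ≡ J
  greedy-unique v≈w ([] _)      ([] _)      = ≡.refl
  greedy-unique v≈w (take _ p)  (take _ q)  = ≡.cong (outside ∷_) (greedy-unique (∙-congˡ v≈w) p q)
  greedy-unique v≈w (skip _ p)  (skip _ q)  = ≡.cong (inside ∷_) (greedy-unique v≈w p q)
  greedy-unique v≈w (take lt _) (skip gt _) = contradiction
    (≡.subst₂ _<_ (len-cong (∙-congˡ v≈w)) (len-cong v≈w) lt) (ℕ.<-asym gt)
  greedy-unique v≈w (skip gt _) (take lt _) = contradiction
    (≡.subst₂ _<_ (len-cong v≈w) (len-cong (∙-congˡ v≈w)) gt) (ℕ.<-asym lt)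

  -- The smaller position i is skipped by the greedy reading but used by J. Both agree before i, so
  -- its letter would begin a reduced word of what remains and be a descent.
  greedy-no-swap : ∀ {m} {Q : Vec S m} {w I J j} → Greedy Q w I → Facet Q w J → ¬ Swap I J j
  greedy-no-swap {Q = q ∷ Q} {J = _ ∷ J} (skip gt gr) f (swap here (there e) _) =
    ℕ.<-asym gt (proj₂ (reduced-tail q (complementWord Q J) f))
  greedy-no-swap (skip gt gr) f (swap (there d) (there e) i<j) = greedy-no-swap gr f (swap d e (s<s⁻¹ i<j))
  greedy-no-swap {Q = q ∷ Q} {J = _ ∷ J} (take lt gr) f (swap (there d) (there e) i<j) =
    greedy-no-swap gr (proj₁ (reduced-tail q (complementWord Q J) f)) (swap d e (s<s⁻¹ i<j))

  swap-free⇒greedy : ∀ {m} (Q : Vec S m) {w I} → Facet Q w I →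
    (∀ J j → Facet Q w J → ¬ Swap I J j) → Greedy Q w I
  swap-free⇒greedy [] {I = []} (ε≈w , _) _ = [] (sym ε≈w)
  swap-free⇒greedy (q ∷ Q) {I = outside ∷ I} f free with reduced-tail q (complementWord Q I) f
  ... | f′ , lt = take lt (swap-free⇒greedy Q f′ λ J j fJ (swap d e i<j) →
    free (outside ∷ J) (suc j) (reduced-∷ q (complementWord Q J) fJ lt) (swap (there d) (there e) (s<s i<j)))
  swap-free⇒greedy (q ∷ Q) {w} {inside ∷ I} f free with descent? q w
  ... | inj₂ gt = skip gt (swap-free⇒greedy Q f λ J j fJ (swap d e i<j) →
    free (inside ∷ J) (suc j) fJ (swap (there d) (there e) (s<s i<j)))
  -- A skipped descent allows a flip: the first letter is put to use, and exchange frees a later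
  -- position `suc j`.
  ... | inj₁ lt with exchange-facet Q I f lt
  ...   | J , fJ , j , d = contradiction (swap here (there d) z<s)
    (free (outside ∷ J) (suc j) (reduced-∷ q (complementWord Q J) fJ lt))

  flip⇒swap : ∀ {m} {Q : Vec S m} {w I J} (e : IncreasingFlip Q w I J) →
    Swap I J (IncreasingFlip.j e)
  flip⇒swap e = swap (≡.subst (Drop _ _) adjacent (∈⇒drop i∈I)) (∈⇒drop j∈J) i<j
    where open IncreasingFlip e

  swap⇒flip : ∀ {m} {Q : Vec S m} {w I J j} → Facet Q w I → Facet Q w J → Swap I J j →
    IncreasingFlip Q w I J
  swap⇒flip {j = j} fI fJ s@(swap {i = i} d e i<j) = record
    { facetˡ = fI ; facetʳ = fJ ; distinct = swap-distinct s ; i = i ; j = j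
    ; i∈I = drop-∈ d ; j∈J = drop-∈ e
    ; adjacent = ≡.trans (drop-≡ d) (≡.sym (drop-≡ e)) ; i<j = i<j }

  sink⇒greedy : ∀ {m} {Q : Vec S m} {w I} → IsSink (increasingFlipGraph Q w) I → Greedy Q w I
  sink⇒greedy {Q = Q} (f , noEdge) =
    swap-free⇒greedy Q f λ J j fJ s → noEdge J (swap⇒flip f fJ s)

  greedy⇒sink : ∀ {m} {Q : Vec S m} {w I} → Greedy Q w I → IsSink (increasingFlipGraph Q w) I
  greedy⇒sink gr = greedy⇒facet gr , λ J e →
    greedy-no-swap gr (IncreasingFlip.facetʳ e) (flip⇒swap e)

  sink⇒negativeGreedy : ∀ {m} {Q : Vec S m} {w I} →
    IsSink (increasingFlipGraph Q w) I → IsNegativeGreedyFacet Q w I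
  sink⇒negativeGreedy sink = sink , λ J sinkJ →
    greedy-unique refl (sink⇒greedy sinkJ) (sink⇒greedy sink)

  negativeGreedy-exists : ∀ {m} (Q : Vec S m) I {w} → Facet Q w I →
    ∃[ N ] IsNegativeGreedyFacet Q w N
  negativeGreedy-exists Q I f with greedy-exists Q I f
  ... | N , gr = N , sink⇒negativeGreedy (greedy⇒sink gr)

  -- Comparing the greedy facets of v and v s.

  deletion-∷ʳ : ∀ u {s v} → Deletion (u ++ [ s ]) v →
    v ≡ u ⊎ (∃[ u′ ] Deletion u u′ × v ≡ u′ ++ [ s ])
  deletion-∷ʳ []      here = inj₁ ≡.refl
  deletion-∷ʳ (t ∷ u) here = inj₂ (u , here , ≡.refl)
  deletion-∷ʳ (t ∷ u) (there d) with deletion-∷ʳ u d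
  ... | inj₁ ≡.refl = inj₁ ≡.refl
  ... | inj₂ (u′ , d′ , ≡.refl) = inj₂ (t ∷ u′ , there d′ , ≡.refl)

  -- A case of the lifting property. Let u be reduced for v. Exchange deletes a letter from u s;
  -- were it a letter of u, then q v would be shorter than v. So it is s, and u remains.
  lifting : ∀ {q s v} → len v < len (v ∙ g s) → len v < len (g q ∙ v) →
    len (g q ∙ (v ∙ g s)) < len (v ∙ g s) → g q ∙ (v ∙ g s) ≈ v
  lifting {q} {s} {v} v<vs v<qv qvs<vs with reducedExpression v
  ... | u , r@(u≈v , _) with exchangeˡ (u ++ [ s ]) q (trans (eval-∷ʳ u s) (∙-congʳ u≈v)) (ℕ.<⇒≤ qvs<vs)
  ...   | x , d , x≈ with deletion-∷ʳ u d
  ...     | inj₁ ≡.refl = trans (sym x≈) u≈v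
  ...     | inj₂ (u′ , d′ , ≡.refl) = contradiction
    (ℕ.<-≤-trans v<qv (ℕ.≤-trans (len-≤ u′ u′≈qv) (ℕ.n≤1+n _)))
    (ℕ.<-irrefl (≡.trans (≡.sym (length-reduced u r)) (length-deletion d′)))
    where
    u′≈qv : eval u′ ≈ g q ∙ v
    u′≈qv = trans (sym (cancelʳ s _)) (trans (∙-congʳ (trans (sym (eval-∷ʳ u′ s)) (trans x≈ (sym (assoc _ _ _)))))
      (cancelʳ s _))

  -- The two readings agree until a letter is an ascent of v and a descent of w = v s. There
  -- `lifting` gives q w = v, and from then on both readings write v. They cannot agree to the end,
  -- because v and w differ in length.
  greedy-drop : ∀ {m} {Q : Vec S m} {v w s I J} → w ≈ v ∙ g s → len v < len w →
    Greedy Q v I → Greedy Q w J → ∃[ i ] Drop I i J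
  greedy-drop w≈ v<w ([] v≈ε) ([] w≈ε) =
    contradiction v<w (ℕ.<-irrefl (len-cong (trans v≈ε (sym w≈ε))))
  greedy-drop {v = v} {w} {s} w≈ v<w (take {q = q} lt p) (take lt′ p′)
    with greedy-drop (trans (∙-congˡ w≈) (sym (assoc _ _ _)))
           (s<s⁻¹ (ℕ.≤-<-trans lt (ℕ.<-≤-trans v<w (len-∙ˡ⁻ q w)))) p p′
  ... | i , d = suc i , there d
  greedy-drop w≈ v<w (skip gt p) (skip gt′ p′) with greedy-drop w≈ v<w p p′
  ... | i , d = suc i , there d
  -- If q is a descent of v, then q w = (q v) s has length at most that of v, so q cannot be an
  -- ascent of w.
  greedy-drop {v = v} {w} {s} w≈ v<w (take {q = q} lt p) (skip gt′ p′) = contradiction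
    (ℕ.≤-<-trans (ℕ.≤-reflexive (len-cong (trans (∙-congˡ w≈) (sym (assoc _ _ _)))))
      (ℕ.≤-<-trans (len-∙ʳ (g q ∙ v) s) (ℕ.≤-<-trans lt (ℕ.<-trans v<w gt′))))
    (ℕ.<-irrefl ≡.refl)
  greedy-drop {v = v} {w} {s} w≈ v<w (skip {q = q} gt p) (take lt′ p′)
    with greedy-unique (trans (sym (lifting {q} {s} {v} (≡.subst (len v <_) (len-cong w≈) v<w) gt
           (≡.subst₂ _<_ (len-cong (∙-congˡ w≈)) (len-cong w≈) lt′))) (sym (∙-congˡ w≈))) p p′
  ... | ≡.refl = zero , here

  -- Otherwise q times the word of J, which is reduced for w, would equal the word of I, which has
  -- two letters fewer.
  dropped-shorter : ∀ {m} (Q : Vec S m) {q w J I j} → Facet (q ∷ Q) w (outside ∷ J) → Drop I j J →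
    ¬ (eval (complementWord Q J) ≈ g q ∙ eval (complementWord Q I))
  dropped-shorter Q {I = I} (≈w , min) d eq = contradiction
    (min (complementWord Q I) (trans (sym (cancelˡ _ _)) (trans (∙-congˡ (sym eq)) ≈w)))
    (ℕ.<⇒≱ (ℕ.m<n⇒m<1+n (ℕ.≤-reflexive (≡.sym (length-deletion (drop⇒deletion Q d))))))

  -- Letters before the first deletion cancel. If only one word deletes the letter reached next,
  -- `dropped-shorter` excludes that the two are equal.
  drop-unique : ∀ {m} (Q : Vec S m) {w I I′ J i i′} → Facet Q w J →
    Drop I i J → Drop I′ i′ J →
    eval (complementWord Q I) ≈ eval (complementWord Q I′) → I ≡ I′
  drop-unique (q ∷ Q) f here here _ = ≡.refl
  drop-unique (q ∷ Q) f (there {b = inside} d) (there d′) eq =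
    ≡.cong (inside ∷_) (drop-unique Q f d d′ eq)
  drop-unique (q ∷ Q) {J = _ ∷ J} f (there {b = outside} d) (there d′) eq =
    ≡.cong (outside ∷_) (drop-unique Q (proj₁ (reduced-tail q (complementWord Q J) f)) d d′
      (trans (sym (cancelˡ q _)) (trans (∙-congˡ eq) (cancelˡ q _))))
  drop-unique (q ∷ Q) f here (there d′) eq = contradiction eq (dropped-shorter Q f d′)
  drop-unique (q ∷ Q) f (there d) here eq  = contradiction (sym eq) (dropped-shorter Q f d)

-- Auxiliary facts on linked lists and digraphs.

module _ {a r} {A : Set a} {R : A → A → Set r} where

  linked-∷ʳ⁺ : ∀ {xs y} → Linked R xs → All (λ x → R x y) xs → Linked R (xs ++ [ y ])
  linked-∷ʳ⁺ []           []        = [-]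
  linked-∷ʳ⁺ [-]          (r ∷ [])  = r ∷ [-]
  linked-∷ʳ⁺ (r ∷ rs)     (_ ∷ all) = r ∷ linked-∷ʳ⁺ rs all

  linked-++⁻ˡ : ∀ xs {ys} → Linked R (xs ++ ys) → Linked R xs
  linked-++⁻ˡ []           _        = []
  linked-++⁻ˡ (x ∷ [])     _        = [-]
  linked-++⁻ˡ (x ∷ y ∷ xs) (r ∷ rs) = r ∷ linked-++⁻ˡ (y ∷ xs) rs

module _ {V : Set} {ℓ : Level} where

  ≐-trans : {G H K : Digraph V ℓ} → G ≐ H → H ≐ K → G ≐ K
  ≐-trans (v , e) (v′ , e′) =
    (λ X → mk⇔ (Equivalence.to (v′ X) ∘ Equivalence.to (v X))
               (Equivalence.from (v X) ∘ Equivalence.from (v′ X))) ,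
    (λ X Y → mk⇔ (Equivalence.to (e′ X Y) ∘ Equivalence.to (e X Y))
                 (Equivalence.from (e X Y) ∘ Equivalence.from (e′ X Y)))

  ≐-sym : {G H : Digraph V ℓ} → G ≐ H → H ≐ G
  ≐-sym (v , e) =
    (λ X → mk⇔ (Equivalence.from (v X)) (Equivalence.to (v X))) ,
    (λ X Y → mk⇔ (Equivalence.from (e X Y)) (Equivalence.to (e X Y)))

-- This passes between joining with the last position and appending `inside`, the form in which the
-- trees are handled.
widenGraph-⋆-last : ∀ {m ℓ} (T : Digraph (Subset m) ℓ) →
  widenGraph T ⋆ last ≐ image (_∷ʳ inside) T
widenGraph-⋆-last T =
  (λ X → mk⇔ (λ { (_ , (I , v , ≡.refl) , X≡) → I , v , ≡.trans X≡ (∪-last I) })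
             (λ { (I , v , X≡) → widen I , (I , v , ≡.refl) , ≡.trans X≡ (≡.sym (∪-last I)) })) ,
  (λ X Y → mk⇔
    (λ { (_ , _ , (I , J , e , ≡.refl , ≡.refl) , X≡ , Y≡) →
           I , J , e , ≡.trans X≡ (∪-last I) , ≡.trans Y≡ (∪-last J) })
    (λ { (I , J , e , X≡ , Y≡) →
           widen I , widen J , (I , J , e , ≡.refl , ≡.refl) ,
           ≡.trans X≡ (≡.sym (∪-last I)) , ≡.trans Y≡ (≡.sym (∪-last J)) }))

-- Sink trees of the facets with a fixed last bit.

module SinkTree {c ℓ : Level} (W : FiniteCoxeterSystem c ℓ) where
  open FiniteCoxeterSystem W
  open SubwordComplex W
  open CoxeterTheory W
  open SinkTheory W

  private
    g : S → Carrier
    g = generator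

  facet? : ∀ {m} (Q : Vec S m) w I → Dec (Facet Q w I)
  facet? Q w I = reduced? (complementWord Q I) w

  module _ {m} (Q : Vec S m) (q : S) {w : Carrier} (I : Subset m) where

    facet-∷ʳ-inside : Facet Q w I ⇔ Facet (Q ∷ʳ q) w (I ∷ʳ inside)
    facet-∷ʳ-inside = mk⇔
      (≡.subst (λ u → IsReducedExpression u w) (≡.sym (complementWord-∷ʳ-inside Q q I)))
      (≡.subst (λ u → IsReducedExpression u w) (complementWord-∷ʳ-inside Q q I))

    facet-∷ʳ-outside⁻ : Facet (Q ∷ʳ q) w (I ∷ʳ outside) →
      Facet Q (w ∙ g q) I × len (w ∙ g q) < len w
    facet-∷ʳ-outside⁻ f = reduced-init (complementWord Q I)
      (≡.subst (λ u → IsReducedExpression u w) (complementWord-∷ʳ-outside Q q I) f)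

    facet-∷ʳ-outside⁺ : len (w ∙ g q) < len w →
      Facet Q (w ∙ g q) I → Facet (Q ∷ʳ q) w (I ∷ʳ outside)
    facet-∷ʳ-outside⁺ lt f =
      ≡.subst (λ u → IsReducedExpression u w) (≡.sym (complementWord-∷ʳ-outside Q q I))
        (reduced-∷ʳ (complementWord Q I) f lt)

  edges-◅◅ : ∀ {m} (Q : Vec S m) w {I J K} (p : Path Q w I J) (p′ : Path Q w J K) →
    edges Q w (p ◅◅ p′) ≡ edges Q w p ++ edges Q w p′
  edges-◅◅ Q w nil     p′ = ≡.refl
  edges-◅◅ Q w (e ◅ p) p′ = ≡.cong (_ ∷_) (edges-◅◅ Q w p p′)

  nLabels-◅◅ : ∀ {m} (Q : Vec S m) w {I J K} (p : Path Q w I J) (p′ : Path Q w J K) →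
    nLabels Q w (p ◅◅ p′) ≡ nLabels Q w p ++ nLabels Q w p′
  nLabels-◅◅ Q w nil     p′ = ≡.refl
  nLabels-◅◅ Q w (e ◅ p) p′ = ≡.cong (_ ∷_) (nLabels-◅◅ Q w p p′)

  -- The facets with last bit `b`, identified with those of a complex on the shorter word. For
  -- `inside` the element `w′` is w; for `outside` it is w q.
  module Slice {m} (Q : Vec S m) (q : S) (w w′ : Carrier) (b : Bool)
    (facet⇔ : ∀ I → Facet Q w′ I ⇔ Facet (Q ∷ʳ q) w (I ∷ʳ b)) where

    Q⁺ : Vec S (suc m)
    Q⁺ = Q ∷ʳ q

    _²∷ʳb : Subset m × Subset m → Subset (suc m) × Subset (suc m)
    _²∷ʳb = Product.map (_∷ʳ b) (_∷ʳ b)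

    liftFlip : ∀ {I J} → IncreasingFlip Q w′ I J → IncreasingFlip Q⁺ w (I ∷ʳ b) (J ∷ʳ b)
    liftFlip e = swap⇒flip (Equivalence.to (facet⇔ _) (IncreasingFlip.facetˡ e))
                           (Equivalence.to (facet⇔ _) (IncreasingFlip.facetʳ e))
                           (swap-∷ʳ (flip⇒swap e))

    liftPath : ∀ {I J} → Path Q w′ I J → Path Q⁺ w (I ∷ʳ b) (J ∷ʳ b)
    liftPath nil     = nil
    liftPath (e ◅ p) = liftFlip e ◅ liftPath p

    nLabels-lift : ∀ {I J} (p : Path Q w′ I J) →
      nLabels Q⁺ w (liftPath p) ≡ map inject₁ (nLabels Q w′ p)
    nLabels-lift nil     = ≡.refl
    nLabels-lift (e ◅ p) = ≡.cong (_ ∷_) (nLabels-lift p)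

    edges-lift : ∀ {I J} (p : Path Q w′ I J) →
      edges Q⁺ w (liftPath p) ≡ map _²∷ʳb (edges Q w′ p)
    edges-lift nil     = ≡.refl
    edges-lift (e ◅ p) = ≡.cong (_ ∷_) (edges-lift p)

    nRising-lift : ∀ {I J} {p : Path Q w′ I J} → NRising Q w′ p →
      Linked Fin._<_ (map inject₁ (nLabels Q w′ p))
    nRising-lift rising = Linked.map⁺ (Linked.map inject₁-mono-< rising)

    nRising-lower : ∀ {I J} {p : Path Q w′ I J} →
      Linked Fin._<_ (map inject₁ (nLabels Q w′ p)) → NRising Q w′ p
    nRising-lower rising = Linked.map inject₁-cancel-< (Linked.map⁻ rising)

    lowerFlip : ∀ {I J j} → Swap I J j → (e : IncreasingFlip Q⁺ w (I ∷ʳ b) (J ∷ʳ b)) →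
      IncreasingFlip Q w′ I J
    lowerFlip s e = swap⇒flip (Equivalence.from (facet⇔ _) (IncreasingFlip.facetˡ e))
                              (Equivalence.from (facet⇔ _) (IncreasingFlip.facetʳ e)) s

    -- No flip leaves the slice. This always holds for `inside`, and for `outside` when no facet
    -- contains the last position.
    Closed : Set ℓ
    Closed = ∀ I J c → IncreasingFlip Q⁺ w (I ∷ʳ b) (J ∷ʳ c) → b ≡ c

    module _ (closed : Closed) where

      lowerPath : ∀ {A N} (p : Path Q⁺ w A N) {I} → A ≡ I ∷ʳ b →
        ∃[ J ] N ≡ J ∷ʳ b × (Σ[ p′ ∈ Path Q w′ I J ]
          nLabels Q⁺ w p ≡ map inject₁ (nLabels Q w′ p′) ×
          edges Q⁺ w p ≡ map _²∷ʳb (edges Q w′ p′))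
      lowerPath nil A≡ = _ , A≡ , nil , ≡.refl , ≡.refl
      lowerPath (_◅_ {j = C} e p) {I} ≡.refl with Vec.initLast C
      ... | C′ , d , ≡.refl with closed I C′ d e
      ...   | ≡.refl with IncreasingFlip.j e | swapView I C′ (flip⇒swap e)
      -- Abstracting the label along with the view identifies it with the image of the lowered label
      -- under `inject₁`.
      ...     | _ | swapInit s with lowerPath p ≡.refl
      ...       | J , N≡ , p′ , labels≡ , edges≡ =
                  J , N≡ , lowerFlip s e ◅ p′ , ≡.cong₂ _∷_ ≡.refl labels≡ , ≡.cong (_ ∷_) edges≡

      negativeGreedy-lift : ∀ {N} → IsNegativeGreedyFacet Q w′ N →
        IsNegativeGreedyFacet Q⁺ w (N ∷ʳ b)
      negativeGreedy-lift {N} ((f , noEdge) , _) = sink⇒negativeGreedy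
        (Equivalence.to (facet⇔ N) f , no-flip)
        where
        no-flip : ∀ Y → ¬ IncreasingFlip Q⁺ w (N ∷ʳ b) Y
        no-flip Y e with Vec.initLast Y
        ... | Y′ , d , ≡.refl with closed N Y′ d e
        ...   | ≡.refl with IncreasingFlip.j e | swapView N Y′ (flip⇒swap e)
        ...     | _ | swapInit s = noEdge Y′ (lowerFlip s e)

      negativeGreedy-lower : ∀ {N} → IsNegativeGreedyFacet Q⁺ w (N ∷ʳ b) →
        IsNegativeGreedyFacet Q w′ N
      negativeGreedy-lower {N} ((f , noEdge) , _) = sink⇒negativeGreedy
        (Equivalence.from (facet⇔ N) f , λ Y e → noEdge (Y ∷ʳ b) (liftFlip e))

      treeEdge-lift : ∀ {X Y} → Edge (negativeSinkTree Q w′) X Y →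
        Edge (negativeSinkTree Q⁺ w) (X ∷ʳ b) (Y ∷ʳ b)
      treeEdge-lift (I , N , f , greedy , p , rising , XY∈p) =
        I ∷ʳ b , N ∷ʳ b , Equivalence.to (facet⇔ I) f , negativeGreedy-lift greedy , liftPath p ,
        ≡.subst (Linked Fin._<_) (≡.sym (nLabels-lift p)) (nRising-lift {p = p} rising) ,
        ≡.subst (_ ∈ˡ_) (≡.sym (edges-lift p)) (∈-map⁺ _²∷ʳb XY∈p)

      treeEdge-lower : ∀ {I N X Y} → Facet Q⁺ w (I ∷ʳ b) → IsNegativeGreedyFacet Q⁺ w N →
        (p : Path Q⁺ w (I ∷ʳ b) N) → NRising Q⁺ w p → (X , Y) ∈ˡ edges Q⁺ w p →
        Edge (image (_∷ʳ b) (negativeSinkTree Q w′)) X Y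
      treeEdge-lower {I} f greedy p rising XY∈p with lowerPath p ≡.refl
      ... | N , ≡.refl , p′ , labels≡ , edges≡
        with ∈-map⁻ _²∷ʳb (≡.subst (_ ∈ˡ_) edges≡ XY∈p)
      ...   | (X , Y) , XY∈p′ , ≡.refl = X , Y ,
        (I , N , Equivalence.from (facet⇔ I) f , negativeGreedy-lower greedy , p′ ,
         nRising-lower {p = p′} (≡.subst (Linked Fin._<_) labels≡ rising) , XY∈p′) ,
        ≡.refl , ≡.refl

      tree-whole : (∀ I c → Facet Q⁺ w (I ∷ʳ c) → c ≡ b) →
        negativeSinkTree Q⁺ w ≐ image (_∷ʳ b) (negativeSinkTree Q w′)
      tree-whole all-b = (λ X → mk⇔ (vertex X) λ { (I , f , ≡.refl) → Equivalence.to (facet⇔ I) f }) ,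
        (λ X Y → mk⇔ edge λ { (_ , _ , e , ≡.refl , ≡.refl) → treeEdge-lift e })
        where
        vertex : ∀ X → Facet Q⁺ w X → ∃[ I ] Facet Q w′ I × X ≡ I ∷ʳ b
        vertex X f with Vec.initLast X
        ... | I , d , ≡.refl with all-b I d f
        ...   | ≡.refl = I , Equivalence.from (facet⇔ I) f , ≡.refl
        edge : ∀ {X Y} → Edge (negativeSinkTree Q⁺ w) X Y →
          Edge (image (_∷ʳ b) (negativeSinkTree Q w′)) X Y
        edge (A , N , f , greedy , p , rising , XY∈p) with Vec.initLast A
        ... | I , d , ≡.refl with all-b I d f
        ...   | ≡.refl = treeEdge-lower f greedy p rising XY∈p

  -- The three cases for the last position.

  module _ {m} (Q : Vec S m) (q : S) (w : Carrier) where

    private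
      Q⁺ : Vec S (suc m)
      Q⁺ = Q ∷ʳ q
      wq : Carrier
      wq = w ∙ g q
      module Inside = Slice Q q w w inside (λ I → facet-∷ʳ-inside Q q I)

      inside-closed : Inside.Closed
      inside-closed I J c e with IncreasingFlip.j e | swapView I J (flip⇒swap e)
      ... | _ | swapInit _ = ≡.refl

    tree-without-last : (∀ I → Facet Q⁺ w I → last ∉ I) →
      negativeSinkTree Q⁺ w ≐ widenGraph (negativeSinkTree Q wq)
    tree-without-last inNone =
      Slice.tree-whole Q q w wq outside outside⇔
        (λ I J c e → ≡.sym (all-outside J c (IncreasingFlip.facetʳ e))) all-outside
      where
      none-inside : ∀ I → ¬ Facet Q⁺ w (I ∷ʳ inside)
      none-inside I f = inNone (I ∷ʳ inside) f (drop-∈ (drop-last I))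
      all-outside : ∀ I d → Facet Q⁺ w (I ∷ʳ d) → d ≡ outside
      all-outside I outside f = ≡.refl
      all-outside I inside  f = contradiction f (none-inside I)
      -- If w q were not shorter than w, exchange on the right would turn I into a facet for w, and
      -- joining it with the last position would contradict `none-inside`.
      descends : ∀ I → Facet Q wq I → len wq < len w
      descends I f with len w ℕ.≤? len wq
      ... | no  ≰  = ℕ.≰⇒> ≰
      ... | yes ≤wq with exchange-facetʳ Q I f ≤wq
      ...   | J , fJ = contradiction (Equivalence.to (facet-∷ʳ-inside Q q J) fJ) (none-inside J)
      outside⇔ : ∀ I → Facet Q wq I ⇔ Facet Q⁺ w (I ∷ʳ outside)
      outside⇔ I = mk⇔ (λ f → facet-∷ʳ-outside⁺ Q q I (descends I f) f)
                       (λ f → proj₁ (facet-∷ʳ-outside⁻ Q q I f))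

    tree-with-last : (∀ I → Facet Q⁺ w I → last ∈ I) →
      negativeSinkTree Q⁺ w ≐ image (_∷ʳ inside) (negativeSinkTree Q w)
    tree-with-last inAll = Inside.tree-whole inside-closed λ I d f → last∈∷ʳ I (inAll (I ∷ʳ d) f)

    module Mixed (lt : len wq < len w) (I₁ I₂ : Subset m)
      (f₁ : Facet Q wq I₁) (f₂ : Facet Q w I₂) where

      module Outside = Slice Q q w wq outside (λ I →
        mk⇔ (facet-∷ʳ-outside⁺ Q q I lt) (λ f → proj₁ (facet-∷ʳ-outside⁻ Q q I f)))

      N₁ N₂ : Subset m
      N₁ = proj₁ (negativeGreedy-exists Q I₁ f₁)
      N₂ = proj₁ (negativeGreedy-exists Q I₂ f₂)

      greedy₁ : IsNegativeGreedyFacet Q wq N₁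
      greedy₁ = proj₂ (negativeGreedy-exists Q I₁ f₁)

      greedy₂ : IsNegativeGreedyFacet Q w N₂
      greedy₂ = proj₂ (negativeGreedy-exists Q I₂ f₂)

      greedy : IsNegativeGreedyFacet Q⁺ w (N₂ ∷ʳ inside)
      greedy = Inside.negativeGreedy-lift inside-closed greedy₂

      N₁-drop : ∃[ i ] Drop N₁ i N₂
      -- The comparison applies to w q and w, since w = (w q) q.
      N₁-drop = greedy-drop (sym (cancelʳ q w)) lt
        (sink⇒greedy (proj₁ greedy₁)) (sink⇒greedy (proj₁ greedy₂))

      bridge : IncreasingFlip Q⁺ w (widen N₁) (N₂ ∷ʳ inside)
      bridge = swap⇒flip (facet-∷ʳ-outside⁺ Q q N₁ lt (proj₁ (proj₁ greedy₁)))
        (proj₁ (proj₁ greedy)) (drop⇒swap-last (proj₂ N₁-drop))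

      -- The complements of J and `N₁` both write w q and both arise by deleting one letter from the
      -- reduced word that `N₂` leaves.
      bridge-unique : ∀ {J i} → Facet Q wq J → Drop J i N₂ → J ≡ N₁
      bridge-unique f d = drop-unique Q (proj₁ (proj₁ greedy₂)) d (proj₂ N₁-drop)
        (trans (proj₁ f) (sym (proj₁ (proj₁ (proj₁ greedy₁)))))

      -- The flip out of the facets without the last position has the largest
      -- possible label, so it ends any rising path.
      crossing : ∀ {A N} (p : Path Q⁺ w A N) {I} → Facet Q wq I → A ≡ widen I →
        N ≡ N₂ ∷ʳ inside → NRising Q⁺ w p →
        Σ[ p′ ∈ Path Q wq I N₁ ]
          nLabels Q⁺ w p ≡ map inject₁ (nLabels Q wq p′) ++ [ last ] ×
          edges Q⁺ w p ≡ map Outside._²∷ʳb (edges Q wq p′) ++ [ (widen N₁ , N₂ ∷ʳ inside) ]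
      crossing nil {I} f ≡.refl N≡ _ = contradiction (∷ʳ-injectiveʳ I N₂ N≡) λ ()
      crossing (_◅_ {j = C} e p) {I} f ≡.refl N≡ rising with Vec.initLast C
      ... | C′ , d , ≡.refl with IncreasingFlip.j e | swapView I C′ (flip⇒swap e)
      crossing (e ◅ p) {I} f ≡.refl N≡ rising | C′ , d , ≡.refl | _ | swapInit s
        with crossing p (proj₁ (facet-∷ʳ-outside⁻ Q q C′ (IncreasingFlip.facetʳ e)))
               ≡.refl N≡ (Linked.tail rising)
      ... | p′ , labels≡ , edges≡ =
        Outside.lowerFlip s e ◅ p′ , ≡.cong₂ _∷_ ≡.refl labels≡ , ≡.cong (_ ∷_) edges≡
      crossing (e ◅ nil) {I} f ≡.refl N≡ rising | C′ , d , ≡.refl | _ | swapLast dr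
        with ∷ʳ-injectiveˡ C′ N₂ N≡
      ... | ≡.refl with bridge-unique f dr
      ...   | ≡.refl = nil , ≡.refl , ≡.refl
      crossing (e ◅ e′ ◅ p) {I} f ≡.refl N≡ (last<j ∷ _) | C′ , d , ≡.refl | _ | swapLast dr =
        contradiction last<j (last≮ _)

      target : Digraph (Subset (suc m)) ℓ
      target = addEdge (union (widenGraph (negativeSinkTree Q wq))
                              (image (_∷ʳ inside) (negativeSinkTree Q w)))
                       (widen N₁) (N₂ ∷ʳ inside)

      vertex⇒ : ∀ X → Facet Q⁺ w X → Vertex target X
      vertex⇒ X f with Vec.initLast X
      ... | I , outside , ≡.refl = inj₁ (I , proj₁ (facet-∷ʳ-outside⁻ Q q I f) , ≡.refl)
      ... | I , inside  , ≡.refl = inj₂ (I , Equivalence.from (facet-∷ʳ-inside Q q I) f , ≡.refl)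

      vertex⇐ : ∀ X → Vertex target X → Facet Q⁺ w X
      vertex⇐ _ (inj₁ (I , f , ≡.refl)) = facet-∷ʳ-outside⁺ Q q I lt f
      vertex⇐ _ (inj₂ (I , f , ≡.refl)) = Equivalence.to (facet-∷ʳ-inside Q q I) f

      -- A rising path that starts with the last position present keeps it. Any other runs to `N₁`
      -- inside the outer slice and ends with the bridge.
      edge⇒ : ∀ X Y → Edge (negativeSinkTree Q⁺ w) X Y → Edge target X Y
      edge⇒ X Y (A , N , f , N-greedy , p , rising , XY∈p) with Vec.initLast A
      ... | I , inside , ≡.refl =
        inj₁ (inj₂ (Inside.treeEdge-lower inside-closed f N-greedy p rising XY∈p))
      ... | I , outside , ≡.refl
        with proj₁ (facet-∷ʳ-outside⁻ Q q I f) | proj₂ greedy N (proj₁ N-greedy)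
      ...   | f′ | N≡ with crossing p f′ ≡.refl N≡ rising
      ...     | p′ , labels≡ , edges≡
        with ∈-++⁻ (map Outside._²∷ʳb (edges Q wq p′)) (≡.subst (_ ∈ˡ_) edges≡ XY∈p)
      ...       | inj₂ (here ≡.refl) = inj₂ (≡.refl , ≡.refl)
      ...       | inj₁ XY∈ with ∈-map⁻ Outside._²∷ʳb XY∈
      ...         | (X′ , Y′) , XY∈p′ , ≡.refl = inj₁ (inj₁ (X′ , Y′ ,
        (I , N₁ , f′ , greedy₁ , p′ ,
         Outside.nRising-lower {p = p′} (linked-++⁻ˡ _ (≡.subst (Linked Fin._<_) labels≡ rising)) ,
         XY∈p′) , ≡.refl , ≡.refl))

      -- A rising path to `N₁` extends by the bridge to a rising path to the sink, because the label
      -- `last` exceeds all the labels lifted by `inject₁`.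
      edge⇐ : ∀ X Y → Edge target X Y → Edge (negativeSinkTree Q⁺ w) X Y
      edge⇐ _ _ (inj₂ (≡.refl , ≡.refl)) =
        widen N₁ , N₂ ∷ʳ inside , IncreasingFlip.facetˡ bridge , greedy ,
        bridge ◅ nil , [-] , here ≡.refl
      edge⇐ _ _ (inj₁ (inj₂ (X , Y , e , ≡.refl , ≡.refl))) = Inside.treeEdge-lift inside-closed e
      edge⇐ _ _ (inj₁ (inj₁ (X , Y , (I , N , f , N-greedy , p , rising , XY∈p) , ≡.refl , ≡.refl)))
        with proj₂ greedy₁ N (proj₁ N-greedy)
      ... | ≡.refl =
        widen I , N₂ ∷ʳ inside , facet-∷ʳ-outside⁺ Q q I lt f , greedy ,
        Outside.liftPath p ◅◅ bridge ◅ nil ,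
        ≡.subst (Linked Fin._<_) (≡.sym labels≡)
          (linked-∷ʳ⁺ (Outside.nRising-lift {p = p} rising)
            (All.map⁺ (All.universal inject₁<last (nLabels Q wq p)))) ,
        ≡.subst (_ ∈ˡ_) (≡.sym edges≡) (∈-++⁺ˡ (∈-map⁺ Outside._²∷ʳb XY∈p))
        where
        labels≡ = ≡.trans (nLabels-◅◅ Q⁺ w (Outside.liftPath p) (bridge ◅ nil))
          (≡.cong (_++ [ last ]) (Outside.nLabels-lift p))
        edges≡ = ≡.trans (edges-◅◅ Q⁺ w (Outside.liftPath p) (bridge ◅ nil))
          (≡.cong (_++ [ (widen N₁ , N₂ ∷ʳ inside) ]) (Outside.edges-lift p))

      tree-mixed : negativeSinkTree Q⁺ w ≐ target
      tree-mixed = (λ X → mk⇔ (vertex⇒ X) (vertex⇐ X)) , (λ X Y → mk⇔ (edge⇒ X Y) (edge⇐ X Y))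

-- Assembling the decomposition of the sink tree.

union-congʳ : ∀ {V : Set} {ℓ : Level} {G H K : Digraph V ℓ} → H ≐ K → union G H ≐ union G K
union-congʳ (v , e) =
  (λ X → mk⇔ (Sum.map₂ (Equivalence.to (v X))) (Sum.map₂ (Equivalence.from (v X)))) ,
  (λ X Y → mk⇔ (Sum.map₂ (Equivalence.to (e X Y))) (Sum.map₂ (Equivalence.from (e X Y))))

addEdge-cong : ∀ {V : Set} {ℓ : Level} {G H : Digraph V ℓ} {A B C} → G ≐ H → B ≡ C →
  addEdge G A B ≐ addEdge H A C
addEdge-cong (v , e) ≡.refl = v ,
  (λ X Y → mk⇔ (Sum.map₁ (Equivalence.to (e X Y))) (Sum.map₁ (Equivalence.from (e X Y))))

widen-⋆-disjoint : ∀ {m ℓ} (T U : Digraph (Subset m) ℓ) → Disjoint (widenGraph T) (widenGraph U ⋆ last)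
widen-⋆-disjoint T U _ ((I , _ , ≡.refl) , (_ , (J , _ , ≡.refl) , eq)) =
  contradiction (∷ʳ-injectiveʳ I J (≡.trans eq (∪-last J))) λ ()

proposition4p17 :
  ∀ {c ℓ} (W : FiniteCoxeterSystem c ℓ) →
  let open FiniteCoxeterSystem W
      open SubwordComplex W
  in
  ∀ {m : ℕ} (Q : Vec S (suc m)) (ρ : Carrier) →
  let Q⊣ = Vec.init Q
      ρq = ρ ∙ generator (Vec.last Q)
      InNone = ∀ I → Facet Q ρ I → last ∉ I
      InAll  = ∀ I → Facet Q ρ I → last ∈ I
  in
    (InNone → negativeSinkTree Q ρ ≐ widenGraph (negativeSinkTree Q⊣ ρq))
  × (InAll → negativeSinkTree Q ρ ≐ widenGraph (negativeSinkTree Q⊣ ρ) ⋆ last)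
  × (¬ InNone → ¬ InAll →
      ∃[ N₁ ] ∃[ N₂ ]
        IsNegativeGreedyFacet Q⊣ ρq N₁
      × IsNegativeGreedyFacet Q⊣ ρ N₂
      × IsNegativeGreedyFacet Q ρ (widen N₂ ∪ ⁅ last ⁆)
      × Disjoint (widenGraph (negativeSinkTree Q⊣ ρq))
                 (widenGraph (negativeSinkTree Q⊣ ρ) ⋆ last)
      × negativeSinkTree Q ρ ≐
          addEdge
            (union (widenGraph (negativeSinkTree Q⊣ ρq))
                   (widenGraph (negativeSinkTree Q⊣ ρ) ⋆ last))
            (widen N₁) (widen N₂ ∪ ⁅ last ⁆))
-- Splitting off the last letter makes `Vec.init` and `Vec.last` in the goal compute.
proposition4p17 W Q ρ with Vec.initLast Q
... | Q⊣ , q , ≡.refl =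
  tree-without-last Q⊣ q ρ ,
  (λ inAll → ≐-trans (tree-with-last Q⊣ q ρ inAll) (≐-sym (widenGraph-⋆-last _))) ,
  mixed
  where
  open FiniteCoxeterSystem W hiding (refl; sym; trans)
  open SubwordComplex W
  open SinkTree W
  mixed : ¬ (∀ I → Facet (Q⊣ ∷ʳ q) ρ I → last ∉ I) → ¬ (∀ I → Facet (Q⊣ ∷ʳ q) ρ I → last ∈ I) → _
  mixed ¬inNone ¬inAll
    -- Facets are decidable and subsets are finitely many, so the two negated hypotheses yield an
    -- actual facet of each kind.
    with anySubset? (λ I → facet? (Q⊣ ∷ʳ q) ρ (I ∷ʳ inside))
       | anySubset? (λ I → facet? (Q⊣ ∷ʳ q) ρ (I ∷ʳ outside))
  ... | no none | _ = contradiction inNone ¬inNone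
    where
    inNone : ∀ I → Facet (Q⊣ ∷ʳ q) ρ I → last ∉ I
    inNone I f last∈I with Vec.initLast I
    ... | I′ , b , ≡.refl with last∈∷ʳ I′ last∈I
    ...   | ≡.refl = none (I′ , f)
  ... | yes _ | no none = contradiction inAll ¬inAll
    where
    inAll : ∀ I → Facet (Q⊣ ∷ʳ q) ρ I → last ∈ I
    inAll I f with Vec.initLast I
    ... | I′ , inside  , ≡.refl = drop-∈ (drop-last I′)
    ... | I′ , outside , ≡.refl = contradiction (I′ , f) none
  ... | yes (I₂ , f₂) | yes (I₁ , f₁) =
    N₁ , N₂ , greedy₁ , greedy₂ ,
    ≡.subst (IsNegativeGreedyFacet (Q⊣ ∷ʳ q) ρ) (≡.sym (∪-last N₂)) greedy ,
    widen-⋆-disjoint (negativeSinkTree Q⊣ (ρ ∙ generator q)) (negativeSinkTree Q⊣ ρ) ,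
    ≐-trans tree-mixed (addEdge-cong (union-congʳ (≐-sym (widenGraph-⋆-last _))) (≡.sym (∪-last N₂)))
    where
    -- A facet without the last position uses q as its final letter, which shows that ρ q is shorter
    -- than ρ.
    f = facet-∷ʳ-outside⁻ Q⊣ q I₁ f₁
    open Mixed Q⊣ q ρ (proj₂ f) I₁ I₂ (proj₁ f) (Equivalence.from (facet-∷ʳ-inside Q⊣ q I₂) f₂)
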